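{- Let $\Gamma$ be the graph specified in the context, i.e. the disjoint union of one folded component and $\frac12\left(\frac{h(-p)}{\mathrm{ord}(\ell)}-1\right)$ stacked components. Then $$\mathrm{MeanDiam}(\Gamma)=\frac12\left(\mathrm{ord}(\ell)+3-\frac{4\,\mathrm{ord}(\ell)}{h(-p)+\mathrm{ord}(\ell)}\right).$$
   Context: Let $p$ be a prime with $p\equiv 71$ or $119\pmod{120}$ and $\ell=2$. Let $h(-p)$ be the class number of $\mathbb{Q}(\sqrt{ -p})$ (it is odd) and let $L=\mathrm{ord}(\ell)$ be the order in the class group of a prime ideal above $2$; $L$ is an odd integer $\ge3$ dividing $h(-p)$. The graph $\Gamma$ (denoted $\Gamma(\mathcal{G}_2(\mathbb{F}_p))$: the supersingular $2$-isogeny graph over $\mathbb{F}_p$ after identifying curves and isogenies up to $\overline{\mathbb{F}_p}$-equivalence, regarded as a simple undirected graph) is the disjoint union of one folded component $\mathcal{F}$ and $\frac12\left(\frac{h(-p)}{L}-1\right)$ stacked components, each a copy of $\mathcal{T}$, where $V(\mathcal{F})=\{0,\dots,L-1\}$, $E(\mathcal{F})=\{\{2k-1,2k+1\}: 1\le k\le \tfrac12(L-3)\}\cup\{\{2k+1,2k+2\}:0\le k\le \tfrac12(L-3)\}\cup\{\{0,1\}\}$, and $V(\mathcal{T})=\{0,\dots,2L-1\}$, $E(\mathcal{T})=\{\{2i,2i+1\}:0\le i\le L-1\}\cup\{\{2i+1,2i+3\}:0\le i\le L-2\}\cup\{\{2L-1,1\}\}$. For a graph with connected components $C_1,\dots,C_m$,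 $\mathrm{MeanDiam}$ is $\frac1m\sum_{i=1}^m\mathrm{diam}(C_i)$. -}

module Defs where

open import Data.Fin.Base using (Fin; toℕ)
open import Data.Integer.Base as ℤ using (ℤ; +_)
open import Data.List.Base using (List; []; _∷_; map; cartesianProductWith)
open import Data.Nat.Base as ℕ using (ℕ; zero; suc; NonZero; _≤_; _<_)
open import Data.Product.Base using (Σ; ∃; ∃₂; _×_; _,_; proj₁; proj₂)
open import Data.Rational.Base as ℚ using (ℚ; 0ℚ; 1ℚ)
open import Data.Sum.Base using (_⊎_)
open import Data.Sum.Relation.Binary.Pointwise using (Pointwise; inj₁; inj₂)
open import Data.Vec.Base using (sum; tabulate)
open import Function.Bundles using (_⇔_)
open import Function.Definitions using (Bijective)
open import Level using (0ℓ)
open import Relation.Binary.Construct.Closure.Symmetric as Sym using (SymClosure)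
open import Relation.Binary.Core using (Rel)
open import Relation.Binary.Definitions using (Symmetric; Irreflexive)
open import Relation.Binary.PropositionalEquality using (_≡_; _≢_; refl; sym)
open import Relation.Nullary.Negation.Core using (¬_)

ℕ→ℚ : ℕ → ℚ
ℕ→ℚ n = (+ n) ℚ./ 1

+-nonZeroʳ : ∀ m n .{{_ : NonZero n}} → NonZero (m ℕ.+ n)
+-nonZeroʳ zero    (suc _) = _
+-nonZeroʳ (suc _) _       = _

------------------------------------------------------------------------
-- The field ℚ(√-p); ⟨ a , b ⟩ stands for a + b√-p.

record ℚ√- (p : ℕ) : Set where
  constructor ⟨_,_⟩
  field
    rat  : ℚ
    surd : ℚ

module _ {p : ℕ} where

  infixl 6 _+ᴷ_
  infixl 7 _*ᴷ_

  _+ᴷ_ _*ᴷ_ : ℚ√- p → ℚ√- p → ℚ√- p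
  ⟨ a , b ⟩ +ᴷ ⟨ c , d ⟩ = ⟨ a ℚ.+ c , b ℚ.+ d ⟩
  ⟨ a , b ⟩ *ᴷ ⟨ c , d ⟩ =
    ⟨ a ℚ.* c ℚ.- ℕ→ℚ p ℚ.* (b ℚ.* d) , a ℚ.* d ℚ.+ b ℚ.* c ⟩

  fromℤ : ℤ → ℚ√- p
  fromℤ n = ⟨ n ℚ./ 1 , 0ℚ ⟩

  0ᴷ 1ᴷ : ℚ√- p
  0ᴷ = fromℤ (+ 0)
  1ᴷ = fromℤ (+ 1)

  -- Horner evaluation: the list c₀ , … , cₙ₋₁ stands for the monic
  -- polynomial c₀ + c₁ X + … + cₙ₋₁ Xⁿ⁻¹ + Xⁿ.
  evalMonic : List ℤ → ℚ√- p → ℚ√- p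
  evalMonic []       x = 1ᴷ
  evalMonic (c ∷ cs) x = fromℤ c +ᴷ x *ᴷ evalMonic cs x

  -- Membership in the ring of integers.
  Integral : ℚ√- p → Set
  Integral x = ∃ λ cs → evalMonic cs x ≡ 0ᴷ

------------------------------------------------------------------------
-- Fractional ideals, presented by finite lists of generators over the
-- ring of integers.  Since that ring is noetherian, these are all the
-- fractional ideals.  Two presentations of one ideal are identified by
-- _≈ᴵ_.

FracIdeal : ℕ → Set
FracIdeal p = List (ℚ√- p)

module _ {p : ℕ} where

  infix 4 _∈ᴵ_ _≈ᴵ_ _∼_
  infixl 7 _*ᴵ_

  _∈ᴵ_ : ℚ√- p → FracIdeal p → Set
  x ∈ᴵ []       = x ≡ 0ᴷ
  x ∈ᴵ (g ∷ gs) = ∃₂ λ r y → Integral r × y ∈ᴵ gs × x ≡ r *ᴷ g +ᴷ y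

  _≈ᴵ_ : Rel (FracIdeal p) 0ℓ
  I ≈ᴵ J = ∀ x → x ∈ᴵ I ⇔ x ∈ᴵ J

  -- Equality in the class group: α I = J for some α ≠ 0.
  _∼_ : Rel (FracIdeal p) 0ℓ
  I ∼ J = ∃ λ α → α ≢ 0ᴷ × map (α *ᴷ_) I ≈ᴵ J

  1ᴵ : FracIdeal p
  1ᴵ = 1ᴷ ∷ []

  _*ᴵ_ : FracIdeal p → FracIdeal p → FracIdeal p
  _*ᴵ_ = cartesianProductWith _*ᴷ_

  _^ᴵ_ : FracIdeal p → ℕ → FracIdeal p
  I ^ᴵ zero  = 1ᴵ
  I ^ᴵ suc n = I *ᴵ (I ^ᴵ n)

  Nonzero : FracIdeal p → Set
  Nonzero I = ∃ λ x → x ∈ᴵ I × x ≢ 0ᴷ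

  record IsPrimeIdeal (P : FracIdeal p) : Set where
    field
      integral : ∀ {x} → x ∈ᴵ P → Integral x
      nonzero  : Nonzero P
      proper   : ¬ (1ᴷ ∈ᴵ P)
      prime    : ∀ {x y} → Integral x → Integral y →
                 x *ᴷ y ∈ᴵ P → x ∈ᴵ P ⊎ y ∈ᴵ P

  IsPrimeIdealAbove : ℕ → FracIdeal p → Set
  IsPrimeIdealAbove ℓ P = IsPrimeIdeal P × fromℤ (+ ℓ) ∈ᴵ P

  record IsClassOrder (I : FracIdeal p) (n : ℕ) : Set where
    field
      positive : 0 < n
      trivial  : I ^ᴵ n ∼ 1ᴵ
      minimal  : ∀ {k} → 0 < k → I ^ᴵ k ∼ 1ᴵ → n ≤ k

-- h is the number of classes of nonzero fractional ideals of ℚ(√-p).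
IsClassNumber : ℕ → ℕ → Set
IsClassNumber p h =
  ∃ λ (rep : Fin h → Σ (FracIdeal p) Nonzero) →
    Bijective _≡_ (λ I J → proj₁ I ∼ proj₁ J) rep

------------------------------------------------------------------------
-- Simple graphs

record SimpleGraph : Set₁ where
  field
    V      : Set
    Adj    : Rel V 0ℓ
    symm   : Symmetric Adj
    irrefl : Irreflexive _≡_ Adj

open SimpleGraph

-- The vertices are 0 , … , n - 1, with an edge {a , b} whenever E a b and
-- a ≢ b.
fromEdges : (n : ℕ) → Rel ℕ 0ℓ → SimpleGraph
fromEdges n E = record
  { V      = Fin n
  ; Adj    = λ u v → u ≢ v × SymClosure E (toℕ u) (toℕ v)
  ; symm   = λ (u≢v , e) → (λ v≡u → u≢v (sym v≡u)) , Sym.symmetric E e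
  ; irrefl = λ u≡v (u≢v , _) → u≢v u≡v
  }

infixr 5 _⊎ᴳ_

_⊎ᴳ_ : SimpleGraph → SimpleGraph → SimpleGraph
G ⊎ᴳ H = record
  { V      = V G ⊎ V H
  ; Adj    = Pointwise (Adj G) (Adj H)
  ; symm   = λ { (inj₁ e) → inj₁ (symm G e) ; (inj₂ e) → inj₂ (symm H e) }
  ; irrefl = λ { refl (inj₁ e) → irrefl G refl e
               ; refl (inj₂ e) → irrefl H refl e }
  }

copies : ℕ → SimpleGraph → SimpleGraph
copies n G = record
  { V      = Fin n × V G
  ; Adj    = λ (i , u) (j , v) → i ≡ j × Adj G u v
  ; symm   = λ (i≡j , e) → sym i≡j , symm G e
  ; irrefl = λ { refl (_ , e) → irrefl G refl e }
  }

data Walk (G : SimpleGraph) : ℕ → Rel (V G) 0ℓ where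
  []  : ∀ {u} → Walk G 0 u u
  _∷_ : ∀ {n u v w} → Adj G u v → Walk G n v w → Walk G (suc n) u w

module _ (G : SimpleGraph) where

  Connected : Rel (V G) 0ℓ
  Connected u v = ∃ λ n → Walk G n u v

  IsDistance : V G → V G → ℕ → Set
  IsDistance u v d = Walk G d u v × (∀ {n} → Walk G n u v → d ≤ n)

  -- The diameter of the connected component of c.  Distances may be taken
  -- in G, as a walk never leaves the component it starts in.
  record IsComponentDiameter (c : V G) (d : ℕ) : Set where
    field
      bounded  : ∀ {u v} → Connected c u → Connected c v →
                 ∃ λ k → IsDistance u v k × k ≤ d
      attained : ∃₂ λ u v → Connected c u × Connected c v × IsDistance u v d

  -- rep chooses one vertex in each of the m connected components.
  record IsMeanDiam (q : ℚ) : Set where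
    field
      m            : ℕ
      {{m-nonZero}} : NonZero m
      rep          : Fin m → V G
      rep-bij      : Bijective _≡_ Connected rep
      diam         : Fin m → ℕ
      diam-correct : ∀ i → IsComponentDiameter (rep i) (diam i)
      mean         : q ≡ (+ sum (tabulate diam)) ℚ./ m

------------------------------------------------------------------------
-- The folded and stacked components, and the isogeny graph they make up

data FoldedEdge (L : ℕ) : Rel ℕ 0ℓ where
  spine : ∀ k → 1 ≤ k → k ≤ (L ℕ.∸ 3) ℕ./ 2 →
          FoldedEdge L (2 ℕ.* k ℕ.∸ 1) (2 ℕ.* k ℕ.+ 1)
  leg   : ∀ k → k ≤ (L ℕ.∸ 3) ℕ./ 2 →
          FoldedEdge L (2 ℕ.* k ℕ.+ 1) (2 ℕ.* k ℕ.+ 2)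
  tip   : FoldedEdge L 0 1

folded : ℕ → SimpleGraph
folded L = fromEdges L (FoldedEdge L)

-- In the bounds, i ≤ L - 1 and i ≤ L - 2 are written without subtraction.
data StackedEdge (L : ℕ) : Rel ℕ 0ℓ where
  leg   : ∀ i → i ℕ.+ 1 ≤ L →
          StackedEdge L (2 ℕ.* i) (2 ℕ.* i ℕ.+ 1)
  rim   : ∀ i → i ℕ.+ 2 ≤ L →
          StackedEdge L (2 ℕ.* i ℕ.+ 1) (2 ℕ.* i ℕ.+ 3)
  close : StackedEdge L (2 ℕ.* L ℕ.∸ 1) 1

stacked : ℕ → SimpleGraph
stacked L = fromEdges (2 ℕ.* L) (StackedEdge L)

-- The divisions are exact when h is odd and L divides h.
stackedCount : (h L : ℕ) .{{_ : NonZero L}} → ℕ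
stackedCount h L = (h ℕ./ L ℕ.∸ 1) ℕ./ 2

isogenyGraph : (h L : ℕ) .{{_ : NonZero L}} → SimpleGraph
isogenyGraph h L = folded L ⊎ᴳ copies (stackedCount h L) (stacked L)

{-# OPTIONS --safe #-}
module Submission where

-- Write L = 2n + 3 and h = (2c + 1) L.  The folded component is a path of
-- n + 1 spine vertices with a leaf on each and a second leaf on the first, so
-- its diameter is n + 2; a stacked component is an L-cycle with a leaf on each
-- vertex, so its diameter is (n + 1) + 2.  With c stacked components the mean
-- is ((n + 2) + c (n + 3)) / (c + 1).
--
-- Upper bounds on distances come from explicit walks.  Lower bounds come from
-- the distance to the leaf 0, which changes by at most 1 along an edge.
-- Because the existence of a walk of given length is decidable, exact
-- distances then exist constructively.

open import Defs
open import Data.Empty using (⊥-elim)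
open import Data.Fin.Base using (Fin; zero; suc; toℕ)
import Data.Fin.Properties as Fin
open import Data.Integer.Base as ℤ using (+_)
import Data.Integer.Properties as ℤ
import Data.Integer.Tactic.RingSolver as ℤ-solver
open import Data.Nat.Base as ℕ
  using (ℕ; zero; suc; NonZero; _≤_; _<_; z≤n; s≤s; z<s; _%_; _∸_; _⊓_)
open import Data.Nat.Divisibility
  using (_∣_; divides; ∣-trans; m%n≡0⇒n∣m; n∣m⇒m%n≡0)
open import Data.Nat.DivMod
  using (_mod_; m%n<n; m<n⇒m%n≡m; m*n/n≡m; m≡m%n+[m/n]*n; /-monoˡ-≤)
open import Data.Nat.Primality using (Prime)
import Data.Nat.Properties as ℕ
import Data.Nat.Tactic.RingSolver as ℕ-solver
open import Data.Product.Base using (∃; ∃₂; _×_; _,_; proj₁; proj₂)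
open import Data.Rational.Base using (_+_; _-_; -_; _*_; _/_; ½; toℚᵘ)
import Data.Rational.Properties as ℚ
open import Data.Rational.Unnormalised.Base as ℚᵘ using (*≡*)
import Data.Rational.Unnormalised.Properties as ℚᵘ
open import Data.Sum.Base using (_⊎_; inj₁; inj₂)
open import Data.Sum.Relation.Binary.Pointwise using (inj₁; inj₂)
open import Data.Vec.Base using (sum; tabulate)
open import Function.Base using (_∘_; case_of_)
open import Function.Definitions using (Injective)
open import Level using (0ℓ)
open import Relation.Binary.Construct.Closure.Symmetric using (fwd; bwd)
open import Relation.Binary.Consequences using (wlog)
open import Relation.Binary.Core using (Rel)
open import Relation.Binary.Definitions using (Decidable; Symmetric)
open import Relation.Binary.PropositionalEquality
  using (_≡_; _≢_; refl; sym; trans; cong; cong₂; subst; subst₂)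
open import Relation.Nullary.Decidable using (Dec; yes; no; map′; ¬?; _×-dec_; _⊎-dec_)
import Relation.Unary as Unary

open SimpleGraph

-- Walks and distances

module _ {G : SimpleGraph} where

  _++_ : ∀ {m n u v w} → Walk G m u v → Walk G n v w → Walk G (m ℕ.+ n) u w
  []      ++ q = q
  (e ∷ p) ++ q = e ∷ (p ++ q)

  snoc : ∀ {n u v w} → Walk G n u v → Adj G v w → Walk G (suc n) u w
  snoc []      e = e ∷ []
  snoc (d ∷ p) e = d ∷ snoc p e

  reverse : ∀ {n u v} → Walk G n u v → Walk G n v u
  reverse []      = []
  reverse (e ∷ p) = snoc (reverse p) (symm G e)

  -- Summing the one-step bound along the walk turns a potential on the vertices into a lower bound
  -- for walk lengths.
  walk-lipschitz : (f : V G → ℕ) → (∀ {u v} → Adj G u v → f u ≤ suc (f v)) →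
                   ∀ {n u v} → Walk G n u v → f u ≤ n ℕ.+ f v
  walk-lipschitz f f-lip []      = ℕ.≤-refl
  walk-lipschitz f f-lip (e ∷ p) =
    ℕ.≤-trans (f-lip e) (s≤s (walk-lipschitz f f-lip p))

  walk-along : (f : ℕ → V G) (N : ℕ) → (∀ {i} → i < N → Adj G (f i) (f (suc i))) →
               ∀ k {i} → k ℕ.+ i ≤ N → Walk G k (f i) (f (k ℕ.+ i))
  walk-along f N step zero    _  = []
  walk-along f N step (suc k) le = snoc (walk-along f N step k (ℕ.<⇒≤ le)) (step le)

Within : (G : SimpleGraph) → ℕ → Rel (V G) 0ℓ
Within G d u v = ∃ λ k → k ≤ d × Walk G k u v

within-sym : ∀ G {d} → Symmetric (Within G d)
within-sym G (k , k≤d , p) = k , k≤d , reverse p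

-- Leaving `u` for its hub and entering `v` from its hub cost at most one step each. Walks reverse,
-- so ordered pairs of hubs suffice.
within-by-hubs : ∀ G (f : ℕ → V G) N {d} →
                 (∀ u → ∃ λ i → i ≤ N × Within G 1 u (f i)) →
                 (∀ i j → i ≤ j → j ≤ N → Within G d (f i) (f j)) →
                 ∀ u v → Within G (2 ℕ.+ d) u v
within-by-hubs G f N {d} hub core u v =
  let i , i≤N , a , a≤1 , p = hub u
      j , j≤N , b , b≤1 , q = hub v
      c , c≤d , r = wlog ℕ.≤-total
        (λ w i≤N j≤N → within-sym G (w j≤N i≤N))
        (λ i j i≤j _ j≤N → core i j i≤j j≤N) i j i≤N j≤N
  in  a ℕ.+ (b ℕ.+ c)
    , ℕ.+-mono-≤ a≤1 (ℕ.+-mono-≤ b≤1 c≤d)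
    , subst (λ k → Walk G (a ℕ.+ k) u v) (ℕ.+-comm c b) (p ++ (r ++ reverse q))

-- An upward search from 0, made constructive by decidability; the known witness bounds it.
least : ∀ {P : ℕ → Set} → Unary.Decidable P → ∀ {n} → P n →
        ∃ λ m → P m × m ≤ n × (∀ {k} → P k → m ≤ k)
least P? {zero}  p = 0 , p , z≤n , λ _ → z≤n
least {P} P? {suc n} p with P? 0
... | yes p₀ = 0 , p₀ , z≤n , λ _ → z≤n
... | no ¬p₀ =
  let m , pm , m≤n , min = least {P ∘ suc} (P? ∘ suc) p
  in  suc m , pm , s≤s m≤n
    , λ { {zero} p₀ → ⊥-elim (¬p₀ p₀) ; {suc k} pk → s≤s (min pk) }

record HasDiameter (G : SimpleGraph) (d : ℕ) : Set where
  field
    bounded  : ∀ u v → ∃ λ k → IsDistance G u v k × k ≤ d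
    attained : ∃₂ λ u v → IsDistance G u v d

-- The potential `f` drops from `d` to 0 between `u` and `v`, so no walk joining them is shorter
-- than `d`; the upper bound makes this pair extremal.
hasDiameter : ∀ G {d} → (∀ n u v → Dec (Walk G n u v)) →
              (∀ u v → Within G d u v) →
              (f : V G → ℕ) → (∀ {u v} → Adj G u v → f u ≤ suc (f v)) →
              ∀ {u v} → f u ≡ d → f v ≡ 0 → HasDiameter G d
hasDiameter G {d} walk? within f f-lip {u} {v} fu≡d fv≡0 =
  record { bounded = bounded ; attained = u , v , attained }
  where
  bounded : ∀ u v → ∃ λ k → IsDistance G u v k × k ≤ d
  bounded u v =
    let n , n≤d , p = within u v
        k , q , k≤n , min = least (λ k → walk? k u v) p
    in  k , (q , min) , ℕ.≤-trans k≤n n≤d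

  d≤ : ∀ {n} → Walk G n u v → d ≤ n
  d≤ {n} p = subst₂ _≤_ fu≡d (trans (cong (n ℕ.+_) fv≡0) (ℕ.+-identityʳ n))
                    (walk-lipschitz f f-lip p)

  attained : IsDistance G u v d
  attained with within u v
  -- The walk supplied by the upper bound is squeezed to length exactly `d`.
  ... | n , n≤d , p with ℕ.≤-antisym n≤d (d≤ p)
  ... | refl = p , d≤

-- Components of a larger graph

-- φ identifies G with a union of connected components of H.
record IsClosedEmbedding (G H : SimpleGraph) (φ : V G → V H) : Set where
  field
    injective : Injective _≡_ _≡_ φ
    preserves : ∀ {u v} → Adj G u v → Adj H (φ u) (φ v)
    lifts     : ∀ {u w} → Adj H (φ u) w → ∃ λ v → w ≡ φ v × Adj G u v

  walk⁺ : ∀ {n u v} → Walk G n u v → Walk H n (φ u) (φ v)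
  walk⁺ []      = []
  walk⁺ (e ∷ p) = preserves e ∷ walk⁺ p

  -- Lifting one edge at a time shows that a walk starting in the image of `φ` never leaves it.
  walk⁻ : ∀ {n u w} → Walk H n (φ u) w → ∃ λ v → w ≡ φ v × Walk G n u v
  walk⁻ []      = _ , refl , []
  walk⁻ (e ∷ p) with lifts e
  ... | _ , refl , e′ =
    let v , eq , p′ = walk⁻ p in v , eq , e′ ∷ p′

  distance⁺ : ∀ {d u v} → IsDistance G u v d → IsDistance H (φ u) (φ v) d
  distance⁺ {u = u} (p , min) = walk⁺ p , λ q →
    let v′ , eq , q′ = walk⁻ q
    in  min (subst (Walk G _ u) (sym (injective eq)) q′)

  -- The bound in `G` makes `G` connected, so the component of `φ c` is the whole image of `φ`, with
  -- the same distances.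
  componentDiameter : ∀ {d} → HasDiameter G d → ∀ c → IsComponentDiameter H (φ c) d
  componentDiameter D c = record
    { bounded  = bounded′
    ; attained =
        let u , v , dist = attained
        in  φ u , φ v , connected u , connected v , distance⁺ dist
    }
    where
    open HasDiameter D

    connected : ∀ u → Connected H (φ c) (φ u)
    connected u = let k , (p , _) , _ = bounded c u in k , walk⁺ p

    bounded′ : ∀ {u v} → Connected H (φ c) u → Connected H (φ c) v →
               ∃ λ k → IsDistance H u v k × k ≤ _
    bounded′ (_ , p) (_ , q) with walk⁻ p | walk⁻ q
    ... | u , refl , _ | v , refl , _ =
      let k , dist , k≤d = bounded u v in k , distance⁺ dist , k≤d

module _ (G H : SimpleGraph) where

  inj₁-closed : IsClosedEmbedding G (G ⊎ᴳ H) inj₁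
  inj₁-closed = record
    { injective = λ { refl → refl }
    ; preserves = inj₁
    ; lifts     = λ { (inj₁ e) → _ , refl , e }
    }

  inj₂-copy-closed : ∀ {c} (i : Fin c) →
                     IsClosedEmbedding H (G ⊎ᴳ copies c H) (λ v → inj₂ (i , v))
  inj₂-copy-closed i = record
    { injective = λ { refl → refl }
    ; preserves = λ e → inj₂ (refl , e)
    ; lifts     = λ { (inj₂ (refl , e)) → _ , refl , e }
    }

sum-tabulate-const : ∀ c a → sum (tabulate {n = c} (λ _ → a)) ≡ c ℕ.* a
sum-tabulate-const zero    a = refl
sum-tabulate-const (suc c) a = cong (a ℕ.+_) (sum-tabulate-const c a)

meanDiam-⊎-copies : ∀ G H c {a b} → V G → V H → HasDiameter G a → HasDiameter H b →
                    IsMeanDiam (G ⊎ᴳ copies c H) (+ (a ℕ.+ c ℕ.* b) / suc c)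
meanDiam-⊎-copies G H c {a} {b} g₀ h₀ DG DH = record
  { m            = suc c
  ; rep          = rep
  ; rep-bij      = rep-injective , rep-surjective
  ; diam         = diam
  ; diam-correct = diam-correct
  ; mean         = cong (λ s → + (a ℕ.+ s) / suc c) (sym (sum-tabulate-const c b))
  }
  where
  K : SimpleGraph
  K = G ⊎ᴳ copies c H

  module E₁ = IsClosedEmbedding (inj₁-closed G (copies c H))
  module E₂ (i : Fin c) = IsClosedEmbedding (inj₂-copy-closed G H i)

  rep : Fin (suc c) → V K
  rep zero    = inj₁ g₀
  rep (suc i) = inj₂ (i , h₀)

  rep-injective : Injective _≡_ (Connected K) rep
  rep-injective {zero}  {zero}  _ = refl
  -- The walk stays in its own summand, so it cannot reach a representative in the other.
  rep-injective {zero}  {suc j} (_ , p) with E₁.walk⁻ p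
  ... | _ , () , _
  rep-injective {suc i} {zero}  (_ , p) with E₂.walk⁻ i p
  ... | _ , () , _
  rep-injective {suc i} {suc j} (_ , p) with E₂.walk⁻ i p
  ... | _ , refl , _ = refl

  rep-surjective : ∀ w → ∃ λ i → ∀ {j} → j ≡ i → Connected K (rep j) w
  rep-surjective (inj₁ v) = zero , λ { refl →
    let k , (p , _) , _ = HasDiameter.bounded DG g₀ v in k , E₁.walk⁺ p }
  rep-surjective (inj₂ (i , v)) = suc i , λ { refl →
    let k , (p , _) , _ = HasDiameter.bounded DH h₀ v in k , E₂.walk⁺ i p }

  diam : Fin (suc c) → ℕ
  diam zero    = a
  diam (suc _) = b

  diam-correct : ∀ i → IsComponentDiameter K (rep i) (diam i)
  diam-correct zero    = E₁.componentDiameter DG g₀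
  diam-correct (suc i) = E₂.componentDiameter i DH h₀

-- Graphs given by labelled edges

-- The two values differ by at most 1; each half serves one orientation of an edge.
AdjacentValues : Rel ℕ 0ℓ
AdjacentValues x y = x ≤ suc y × y ≤ suc x

1+-adjacent : ∀ k → AdjacentValues k (suc k)
1+-adjacent k = ℕ.m≤n⇒m≤1+n (ℕ.n≤1+n k) , ℕ.≤-refl

module _ {n : ℕ} {E : Rel ℕ 0ℓ} where

  private
    G : SimpleGraph
    G = fromEdges n E

  edge : ∀ {u v a b} → toℕ u ≡ a → toℕ v ≡ b → a ≢ b → E a b → Adj G u v
  edge refl refl a≢b e = (λ u≡v → a≢b (cong toℕ u≡v)) , fwd e

  fromEdges-lipschitz : (f : ℕ → ℕ) →
    (∀ {a b} → E a b → AdjacentValues (f a) (f b)) →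
    ∀ {u v} → Adj G u v → f (toℕ u) ≤ suc (f (toℕ v))
  fromEdges-lipschitz f f-lip (_ , fwd e) = proj₁ (f-lip e)
  fromEdges-lipschitz f f-lip (_ , bwd e) = proj₂ (f-lip e)

  module _ (E? : Decidable E) where

    adj? : Decidable (Adj G)
    adj? u v = ¬? (u Fin.≟ v) ×-dec
      map′ (λ { (inj₁ e) → fwd e ; (inj₂ e) → bwd e })
           (λ { (fwd e) → inj₁ e ; (bwd e) → inj₂ e })
           (E? (toℕ u) (toℕ v) ⊎-dec E? (toℕ v) (toℕ u))

    -- The next vertex ranges over a finite set, so each step is a finite search.
    walk? : ∀ k u v → Dec (Walk G k u v)
    walk? zero    u v = map′ (λ { refl → [] }) (λ { [] → refl }) (u Fin.≟ v)
    walk? (suc k) u v =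
      map′ (λ (w , e , p) → e ∷ p) (λ { (e ∷ p) → _ , e , p })
           (Fin.any? λ w → adj? u w ×-dec walk? k w v)

-- Parity of labels and functions given separately on even and odd labels

toℕ-mod : ∀ {k n} .{{_ : NonZero n}} → k < n → toℕ (k mod n) ≡ k
toℕ-mod {k} {n} k<n = trans (Fin.toℕ-fromℕ< (m%n<n k n)) (m<n⇒m%n≡m k<n)

parity : ∀ a → ∃ λ k → a ≡ 2 ℕ.* k ⊎ a ≡ 2 ℕ.* k ℕ.+ 1
parity zero = 0 , inj₁ refl
parity (suc a) with parity a
... | k , inj₁ refl = k , inj₂ (ℕ.+-comm 1 (2 ℕ.* k))
... | k , inj₂ refl = suc k , inj₁ (trans (cong suc (ℕ.+-comm (2 ℕ.* k) 1)) (sym (ℕ.*-suc 2 k)))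

-- Even labels are leaves and odd labels are hubs in both components, so depths are prescribed
-- separately on the two parities.
interleave : (e o : ℕ → ℕ) → ℕ → ℕ
interleave e o zero          = e 0
interleave e o (suc zero)    = o 0
interleave e o (suc (suc a)) = interleave (e ∘ suc) (o ∘ suc) a

interleave-even : ∀ e o k → interleave e o (2 ℕ.* k) ≡ e k
interleave-even e o zero    = refl
interleave-even e o (suc k) rewrite ℕ.+-suc k (k ℕ.+ 0) = interleave-even (e ∘ suc) (o ∘ suc) k

interleave-odd : ∀ e o k → interleave e o (2 ℕ.* k ℕ.+ 1) ≡ o k
interleave-odd e o zero    = refl
interleave-odd e o (suc k) rewrite ℕ.+-suc k (k ℕ.+ 0) = interleave-odd (e ∘ suc) (o ∘ suc) k

2*suc∸1 : ∀ k → 2 ℕ.* suc k ∸ 1 ≡ 2 ℕ.* k ℕ.+ 1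
2*suc∸1 k = trans (ℕ.+-suc k (k ℕ.+ 0)) (ℕ.+-comm 1 (2 ℕ.* k))

2*k+2 : ∀ k → 2 ℕ.* k ℕ.+ 2 ≡ 2 ℕ.* suc k
2*k+2 k = trans (ℕ.+-comm (2 ℕ.* k) 2) (sym (ℕ.*-suc 2 k))

2*k+3 : ∀ k → 2 ℕ.* k ℕ.+ 3 ≡ 2 ℕ.* suc k ℕ.+ 1
2*k+3 = ℕ-solver.solve-∀

2*m≤1+2*n⇒m≤n : ∀ {m n} → 2 ℕ.* m ≤ suc (2 ℕ.* n) → m ≤ n
2*m≤1+2*n⇒m≤n {m} {n} le = ℕ.≮⇒≥ λ n<m → ℕ.<-irrefl refl
  (ℕ.≤-trans (subst (_≤ 2 ℕ.* m) (ℕ.*-suc 2 n) (ℕ.*-monoʳ-≤ 2 n<m)) le)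

-- The folded component

-- Each constructor has a bounded parameter, hence a finite search. The search bound is strict,
-- whence `suc bound`.
FoldedEdge? : ∀ L → Decidable (FoldedEdge L)
FoldedEdge? L a b = map′
  (λ { (inj₁ (k , s≤s k≤ , 1≤k , refl , refl)) → spine k 1≤k k≤
     ; (inj₂ (inj₁ (k , s≤s k≤ , refl , refl))) → leg k k≤
     ; (inj₂ (inj₂ (refl , refl))) → tip })
  (λ { (spine k 1≤k k≤) → inj₁ (k , s≤s k≤ , 1≤k , refl , refl)
     ; (leg k k≤)       → inj₂ (inj₁ (k , s≤s k≤ , refl , refl))
     ; tip              → inj₂ (inj₂ (refl , refl)) })
  (ℕ.anyUpTo? (λ k → 1 ℕ.≤? k ×-dec a ℕ.≟ 2 ℕ.* k ∸ 1 ×-dec b ℕ.≟ 2 ℕ.* k ℕ.+ 1) (suc bound)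
   ⊎-dec
   ℕ.anyUpTo? (λ k → a ℕ.≟ 2 ℕ.* k ℕ.+ 1 ×-dec b ℕ.≟ 2 ℕ.* k ℕ.+ 2) (suc bound)
   ⊎-dec
   a ℕ.≟ 0 ×-dec b ℕ.≟ 1)
  where
  bound = (L ∸ 3) ℕ./ 2

module Folded (n : ℕ) where

  L : ℕ
  L = 3 ℕ.+ n ℕ.* 2

  G : SimpleGraph
  G = folded L

  ≤-range : ∀ {k} → k ≤ n → k ≤ (L ∸ 3) ℕ./ 2
  ≤-range = subst (_ ≤_) (sym (m*n/n≡m n 2))

  -- Reduction mod `L` only makes the function total: for `i ≤ n` the label is already below `L`.
  hub : ℕ → Fin L
  hub i = (2 ℕ.* i ℕ.+ 1) mod L

  toℕ-hub : ∀ {i} → i ≤ n → toℕ (hub i) ≡ 2 ℕ.* i ℕ.+ 1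
  toℕ-hub {i} i≤n = toℕ-mod
    (subst₂ (λ a b → a < 3 ℕ.+ b) (ℕ.+-comm 1 (2 ℕ.* i)) (ℕ.*-comm 2 n)
      (s≤s (s≤s (ℕ.m≤n⇒m≤1+n (ℕ.*-monoʳ-≤ 2 i≤n)))))

  hub-step : ∀ {i} → i < n → Adj G (hub i) (hub (suc i))
  hub-step {i} i<n = edge
    (trans (toℕ-hub (ℕ.<⇒≤ i<n)) (sym (2*suc∸1 i))) (toℕ-hub i<n)
    (ℕ.<⇒≢ (ℕ.≤-<-trans (ℕ.m∸n≤m (2 ℕ.* suc i) 1) (ℕ.m<m+n (2 ℕ.* suc i) z<s)))
    (spine (suc i) (s≤s z≤n) (≤-range i<n))

  near-hub : ∀ u → ∃ λ i → i ≤ n × Within G 1 u (hub i)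
  near-hub u with parity (toℕ u) | subst (toℕ u <_) (cong (3 ℕ.+_) (ℕ.*-comm n 2)) (Fin.toℕ<n u)
  ... | zero , inj₁ eq | _ = 0 , z≤n , 1 , s≤s z≤n ,
    edge eq (toℕ-hub z≤n) (λ ()) tip ∷ []
  -- The leaf `2k + 2` hangs from hub `k`; the leaf 0 is the second one on hub 0.
  ... | suc k , inj₁ eq | u<L = k , k≤n , 1 , s≤s z≤n ,
    symm G {hub k} {u} (edge (toℕ-hub k≤n) (trans eq (sym (2*k+2 k)))
      (ℕ.<⇒≢ (ℕ.+-monoʳ-< (2 ℕ.* k) (s≤s (s≤s z≤n)))) (leg k (≤-range k≤n))) ∷ []
    where
    k≤n : k ≤ n
    k≤n = 2*m≤1+2*n⇒m≤n (ℕ.m≤n⇒m≤1+n (ℕ.s≤s⁻¹ (ℕ.s≤s⁻¹ (ℕ.s≤s⁻¹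
            (subst (_< 3 ℕ.+ 2 ℕ.* n) (trans eq (ℕ.*-suc 2 k)) u<L)))))
  ... | k , inj₂ eq | u<L = k , k≤n , 0 , z≤n ,
    subst (Walk G 0 u) (Fin.toℕ-injective (trans eq (sym (toℕ-hub k≤n)))) []
    where
    k≤n : k ≤ n
    k≤n = 2*m≤1+2*n⇒m≤n (ℕ.s≤s⁻¹ (ℕ.s≤s⁻¹
            (subst (_< 3 ℕ.+ 2 ℕ.* n) (trans eq (ℕ.+-comm (2 ℕ.* k) 1)) u<L)))

  hubs-within : ∀ i j → i ≤ j → j ≤ n → Within G n (hub i) (hub j)
  hubs-within i j i≤j j≤n with j ∸ i | ℕ.m∸n+n≡m i≤j
  ... | k | refl = k , ℕ.m+n≤o⇒m≤o k j≤n , walk-along hub n hub-step k j≤n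

  -- The distance from the leaf 0.
  leafDistance oddDistance depth : ℕ → ℕ
  leafDistance zero    = 0
  leafDistance (suc k) = 2 ℕ.+ k
  oddDistance          = suc
  depth                = interleave leafDistance oddDistance

  depth-even : ∀ k → depth (2 ℕ.* k) ≡ leafDistance k
  depth-even = interleave-even leafDistance oddDistance

  depth-odd : ∀ k → depth (2 ℕ.* k ℕ.+ 1) ≡ oddDistance k
  depth-odd = interleave-odd leafDistance oddDistance

  -- Hub `k` has depth `k + 1` and its leaf `2k + 2` has depth `k + 2`, so every edge changes the
  -- depth by exactly one.
  depth-lipschitz : ∀ {a b} → FoldedEdge L a b → AdjacentValues (depth a) (depth b)
  depth-lipschitz (spine (suc k) _ _) = subst₂ AdjacentValues
    (sym (trans (cong depth (2*suc∸1 k)) (depth-odd k)))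
    (sym (depth-odd (suc k)))
    (1+-adjacent (suc k))
  depth-lipschitz (leg k _) = subst₂ AdjacentValues
    (sym (depth-odd k))
    (sym (trans (cong depth (2*k+2 k)) (depth-even (suc k))))
    (1+-adjacent (suc k))
  depth-lipschitz tip = z≤n , s≤s z≤n

  diameter : HasDiameter G (2 ℕ.+ n)
  diameter = hasDiameter G (walk? (FoldedEdge? L))
    (within-by-hubs G hub n near-hub hubs-within)
    (depth ∘ toℕ) (fromEdges-lipschitz depth depth-lipschitz)
    -- The last leaf, on hub `n` at the far end of the spine, has depth `n + 2`.
    {u = (2 ℕ.* suc n) mod L} {v = zero}
    (trans (cong depth (toℕ-mod (s≤s (ℕ.≤-reflexive (ℕ.*-comm 2 (suc n))))))
           (depth-even (suc n)))
    refl

-- The stacked component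

StackedEdge? : ∀ L → Decidable (StackedEdge L)
StackedEdge? L a b = map′
  (λ { (inj₁ (i , _ , i≤ , refl , refl)) → leg i i≤
     ; (inj₂ (inj₁ (i , _ , i≤ , refl , refl))) → rim i i≤
     ; (inj₂ (inj₂ (refl , refl))) → close })
  (λ { (leg i i≤) → inj₁ (i , i<L i 0 i≤ , i≤ , refl , refl)
     ; (rim i i≤) → inj₂ (inj₁ (i , i<L i 1 i≤ , i≤ , refl , refl))
     ; close      → inj₂ (inj₂ (refl , refl)) })
  (ℕ.anyUpTo? (λ i → i ℕ.+ 1 ℕ.≤? L ×-dec a ℕ.≟ 2 ℕ.* i ×-dec b ℕ.≟ 2 ℕ.* i ℕ.+ 1) L
   ⊎-dec
   ℕ.anyUpTo? (λ i → i ℕ.+ 2 ℕ.≤? L ×-dec a ℕ.≟ 2 ℕ.* i ℕ.+ 1 ×-dec b ℕ.≟ 2 ℕ.* i ℕ.+ 3) L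
   ⊎-dec
   a ℕ.≟ 2 ℕ.* L ∸ 1 ×-dec b ℕ.≟ 1)
  where
  i<L : ∀ i j → i ℕ.+ suc j ≤ L → i < L
  i<L i j = ℕ.<-≤-trans (ℕ.m<m+n i z<s)

module Stacked (n : ℕ) where

  -- `N` is the last rim index, `L - 1`.
  N L : ℕ
  N = 2 ℕ.+ n ℕ.* 2
  L = suc N

  G : SimpleGraph
  G = stacked L

  hub : ℕ → Fin (2 ℕ.* L)
  hub i = (2 ℕ.* i ℕ.+ 1) mod (2 ℕ.* L)

  toℕ-hub : ∀ {i} → i ≤ N → toℕ (hub i) ≡ 2 ℕ.* i ℕ.+ 1
  toℕ-hub {i} i≤N = toℕ-mod (subst (_≤ 2 ℕ.* L)
    (trans (sym (2*k+2 i)) (ℕ.+-suc (2 ℕ.* i) 1)) (ℕ.*-monoʳ-≤ 2 (s≤s i≤N)))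

  hub-step : ∀ {i} → i < N → Adj G (hub i) (hub (suc i))
  hub-step {i} i<N = edge
    (toℕ-hub (ℕ.<⇒≤ i<N)) (trans (toℕ-hub i<N) (sym (2*k+3 i)))
    (ℕ.<⇒≢ (ℕ.+-monoʳ-< (2 ℕ.* i) (s≤s (s≤s z≤n))))
    (rim i (subst (_≤ L) (ℕ.+-comm 2 i) (s≤s i<N)))

  hub-close : Adj G (hub N) (hub 0)
  hub-close = edge (trans (toℕ-hub ℕ.≤-refl) (sym (2*suc∸1 N))) (toℕ-hub z≤n) (λ ()) close

  near-hub : ∀ u → ∃ λ i → i ≤ N × Within G 1 u (hub i)
  near-hub u with parity (toℕ u) | Fin.toℕ<n u
  ... | k , inj₁ eq | u<2L = k , ℕ.s≤s⁻¹ k<L , 1 , s≤s z≤n ,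
    edge eq (toℕ-hub (ℕ.s≤s⁻¹ k<L)) (ℕ.<⇒≢ (ℕ.m<m+n (2 ℕ.* k) z<s))
      (leg k (subst (_≤ L) (ℕ.+-comm 1 k) k<L)) ∷ []
    where
    k<L : k < L
    k<L = ℕ.*-cancelˡ-< 2 k L (subst (_< 2 ℕ.* L) eq u<2L)
  ... | k , inj₂ eq | u<2L = k , ℕ.s≤s⁻¹ k<L , 0 , z≤n ,
    subst (Walk G 0 u) (Fin.toℕ-injective (trans eq (sym (toℕ-hub (ℕ.s≤s⁻¹ k<L))))) []
    where
    k<L : k < L
    k<L = ℕ.*-cancelˡ-< 2 k L
      (ℕ.<-trans (ℕ.m<m+n (2 ℕ.* k) z<s) (subst (_< 2 ℕ.* L) eq u<2L))

  -- The rim is an odd cycle of length 2n + 3, so one of its two arcs between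
  -- hub i and hub j has length at most n + 1.
  hubs-within : ∀ i j → i ≤ j → j ≤ N → Within G (suc n) (hub i) (hub j)
  hubs-within i j i≤j j≤N with j ∸ i | ℕ.m∸n+n≡m i≤j | N ∸ j | ℕ.m∸n+n≡m j≤N
  ... | k | refl | r | r+k+i≡N with k ℕ.≤? suc n
  ... | yes k≤1+n = k , k≤1+n , walk-along hub N hub-step k j≤N
  ... | no  k≰1+n = r ℕ.+ suc i , short , within-arc
    where
    short : r ℕ.+ suc i ≤ suc n
    -- The two arcs, `k` and `r + 1 + i`, add up to `L = (n + 1) + (n + 2)`; since `k` is at least
    -- `n + 2`, the other is at most `n + 1`.
    short = ℕ.+-cancelʳ-≤ (2 ℕ.+ n) _ _ (ℕ.≤-trans
      (ℕ.+-monoʳ-≤ (r ℕ.+ suc i) (ℕ.≰⇒> k≰1+n))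
      (ℕ.≤-reflexive (trans (rearrange r i k) (trans (cong suc r+k+i≡N) (twice n)))))
      where
      rearrange : ∀ r i k → r ℕ.+ (1 ℕ.+ i) ℕ.+ k ≡ 1 ℕ.+ (r ℕ.+ (k ℕ.+ i))
      rearrange = ℕ-solver.solve-∀
      twice : ∀ n → 3 ℕ.+ n ℕ.* 2 ≡ (1 ℕ.+ n) ℕ.+ (2 ℕ.+ n)
      twice = ℕ-solver.solve-∀

    to-end : Walk G r (hub (k ℕ.+ i)) (hub N)
    to-end = subst (λ e → Walk G r (hub (k ℕ.+ i)) (hub e)) r+k+i≡N
      (walk-along hub N hub-step r (ℕ.≤-reflexive r+k+i≡N))

    from-start : Walk G i (hub 0) (hub i)
    from-start = subst (λ e → Walk G i (hub 0) (hub e)) (ℕ.+-identityʳ i)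
      (walk-along hub N hub-step i
        (subst (_≤ N) (sym (ℕ.+-identityʳ i)) (ℕ.≤-trans i≤j j≤N)))

    within-arc : Walk G (r ℕ.+ suc i) (hub i) (hub (k ℕ.+ i))
    -- From hub `k + i` on to hub `N`, across the closing edge to hub 0 and on to hub `i`, then
    -- reversed.
    within-arc = reverse (to-end ++ (hub-close ∷ from-start))

  -- The distance from the leaf 0.
  rimDistance leafDistance oddDistance depth : ℕ → ℕ
  rimDistance i        = i ⊓ (L ∸ i)
  leafDistance zero    = 0
  leafDistance (suc i) = 2 ℕ.+ rimDistance (suc i)
  oddDistance i        = suc (rimDistance i)
  depth                = interleave leafDistance oddDistance

  -- Both arc lengths `i` and `L ∸ i` change by at most one, and the minimum is monotone in each.
  rimDistance-up : ∀ i → rimDistance (suc i) ≤ suc (rimDistance i)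
  rimDistance-up i = ℕ.⊓-mono-≤ {suc i} ℕ.≤-refl (ℕ.m≤n⇒m≤1+n (ℕ.∸-monoʳ-≤ L (ℕ.n≤1+n i)))

  rimDistance-down : ∀ i → rimDistance i ≤ suc (rimDistance (suc i))
  rimDistance-down i = ℕ.⊓-mono-≤ (ℕ.m≤n⇒m≤1+n (ℕ.n≤1+n i))
    (ℕ.m≤n+o⇒m∸n≤o L i (subst (L ≤_) (sym (ℕ.+-suc i (L ∸ suc i))) (ℕ.m≤n+m∸n L (suc i))))

  depth-even : ∀ k → depth (2 ℕ.* k) ≡ leafDistance k
  depth-even = interleave-even leafDistance oddDistance

  depth-odd : ∀ k → depth (2 ℕ.* k ℕ.+ 1) ≡ oddDistance k
  depth-odd = interleave-odd leafDistance oddDistance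

  depth-lipschitz : ∀ {a b} → StackedEdge L a b → AdjacentValues (depth a) (depth b)
  depth-lipschitz (leg zero    _) = z≤n , s≤s z≤n
  depth-lipschitz (leg (suc i) _) = subst₂ AdjacentValues
    (sym (depth-even (suc i))) (sym (depth-odd (suc i)))
    -- The edge runs from leaf to hub, so the depth falls and the two bounds are swapped.
    (let up , down = 1+-adjacent (oddDistance (suc i)) in down , up)
  depth-lipschitz (rim i _) = subst₂ AdjacentValues
    (sym (depth-odd i)) (sym (trans (cong depth (2*k+3 i)) (depth-odd (suc i))))
    (s≤s (rimDistance-down i) , s≤s (rimDistance-up i))
  depth-lipschitz close = subst (λ x → AdjacentValues x 1)
    (sym (trans (cong depth (2*suc∸1 N)) (depth-odd N)))
    -- Hub `N` is at rim distance at most `L - N = 1` from hub 0, whose depth is 1.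
    (s≤s (ℕ.≤-trans (ℕ.m⊓n≤n N (L ∸ N)) (ℕ.≤-reflexive (ℕ.m+n∸n≡m 1 N))) , s≤s z≤n)

  diameter : HasDiameter G (3 ℕ.+ n)
  diameter = hasDiameter G (walk? (StackedEdge? L))
    (within-by-hubs G hub N near-hub hubs-within)
    (depth ∘ toℕ) (fromEdges-lipschitz depth depth-lipschitz)
    -- The leaf on hub `n + 1`: the arcs to hub 0 have lengths `n + 1` and `n + 2`, so its depth is
    -- `n + 3`.
    {u = (2 ℕ.* suc n) mod (2 ℕ.* L)} {v = zero}
    (trans (cong depth (toℕ-mod (ℕ.*-monoʳ-< 2 1+n<L)))
      (trans (depth-even (suc n))
             (cong (2 ℕ.+_) (ℕ.m≤n⇒m⊓n≡m (ℕ.m+n≤o⇒m≤o∸n (suc n) 2[1+n]≤L)))))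
    refl
    where
    2[1+n]≤L : suc n ℕ.+ suc n ≤ L
    2[1+n]≤L = subst (_≤ L) (doubled n) (ℕ.n≤1+n N)
      where
      doubled : ∀ n → 2 ℕ.+ n ℕ.* 2 ≡ (1 ℕ.+ n) ℕ.+ (1 ℕ.+ n)
      doubled = ℕ-solver.solve-∀
    1+n<L : suc n < L
    1+n<L = ℕ.<-≤-trans (ℕ.m<m+n (suc n) z<s) 2[1+n]≤L

-- The arithmetic of the mean

odd⇒half : ∀ a → a % 2 ≡ 1 → a ≡ 1 ℕ.+ a ℕ./ 2 ℕ.* 2
odd⇒half a odd = trans (m≡m%n+[m/n]*n a 2) (cong (ℕ._+ a ℕ./ 2 ℕ.* 2) odd)

∣-odd : ∀ {m n} → m ∣ n → n % 2 ≡ 1 → m % 2 ≡ 1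
∣-odd {m} {n} m∣n n-odd with m % 2 in eq | m%n<n m 2
... | 0           | _ = case trans (sym n-odd) (n∣m⇒m%n≡0 n 2 (∣-trans (m%n≡0⇒n∣m m 2 eq) m∣n)) of λ ()
... | 1           | _ = refl
... | suc (suc _) | s≤s (s≤s ())

stackedCount-odd : ∀ c L .{{_ : NonZero L}} → stackedCount ((1 ℕ.+ c ℕ.* 2) ℕ.* L) L ≡ c
stackedCount-odd c L = trans
  (cong (λ q → (q ∸ 1) ℕ./ 2) (m*n/n≡m (1 ℕ.+ c ℕ.* 2) L)) (m*n/n≡m c 2)

-- With `h = (2c + 1) L` the denominator is `2 (c + 1) L`. The nonzero proof is an argument so that
-- the one in the theorem fits.
4L/[h+L] : ∀ c L .{{_ : NonZero L}} .{{_ : NonZero ((1 ℕ.+ c ℕ.* 2) ℕ.* L ℕ.+ L)}} →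
           + (4 ℕ.* L) / ((1 ℕ.+ c ℕ.* 2) ℕ.* L ℕ.+ L) ≡ + 2 / suc c
4L/[h+L] c L@(suc _) = ℚ.fromℚᵘ-cong {+ (4 ℕ.* L) ℚᵘ./ ((1 ℕ.+ c ℕ.* 2) ℕ.* L ℕ.+ L)} {+ 2 ℚᵘ./ suc c}
  (*≡* (trans (sym (ℤ.pos-* (4 ℕ.* L) (suc c)))
    (trans (cong +_ (cross c L)) (ℤ.pos-* 2 ((1 ℕ.+ c ℕ.* 2) ℕ.* L ℕ.+ L)))))
  where
  cross : ∀ c L → 4 ℕ.* L ℕ.* (1 ℕ.+ c) ≡ 2 ℕ.* ((1 ℕ.+ c ℕ.* 2) ℕ.* L ℕ.+ L)
  cross = ℕ-solver.solve-∀

-- Both sides equal `((n + 3)(c + 1) - 1) / (c + 1)`. Unnormalised rationals reduce the equality to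
-- cross-multiplication.
mean-formula : ∀ n c → ½ * (ℕ→ℚ (3 ℕ.+ n ℕ.* 2) + ℕ→ℚ 3 - + 2 / suc c) ≡
                       + ((2 ℕ.+ n) ℕ.+ c ℕ.* (3 ℕ.+ n)) / suc c
mean-formula n c = ℚ.toℚᵘ-injective (begin
  toℚᵘ (½ * (a + b - d))
    ≈⟨ ℚ.toℚᵘ-homo-* ½ (a + b - d) ⟩
  toℚᵘ ½ ℚᵘ.* toℚᵘ (a + b - d)
    ≈⟨ ℚᵘ.*-congˡ {toℚᵘ ½} (ℚᵘ.≃-trans (ℚ.toℚᵘ-homo-+ (a + b) (- d))
         (ℚᵘ.+-cong
           (ℚᵘ.≃-trans (ℚ.toℚᵘ-homo-+ a b)
             (ℚᵘ.+-cong (ℚ.toℚᵘ-fromℚᵘ a′) (ℚ.toℚᵘ-fromℚᵘ b′)))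
           (ℚᵘ.≃-trans (ℚ.toℚᵘ-homo‿- d) (ℚᵘ.-‿cong (ℚ.toℚᵘ-fromℚᵘ d′))))) ⟩
  toℚᵘ ½ ℚᵘ.* (a′ ℚᵘ.+ b′ ℚᵘ.- d′)
    ≈⟨ *≡* cross-multiplied ⟩
  + s ℚᵘ./ suc c
    ≈⟨ ℚ.toℚᵘ-fromℚᵘ (+ s ℚᵘ./ suc c) ⟨
  toℚᵘ (+ s / suc c) ∎)
  where
  open ℚᵘ.≃-Reasoning
  s = (2 ℕ.+ n) ℕ.+ c ℕ.* (3 ℕ.+ n)
  a = ℕ→ℚ (3 ℕ.+ n ℕ.* 2)
  b = ℕ→ℚ 3
  d = + 2 / suc c
  a′ = + (3 ℕ.+ n ℕ.* 2) ℚᵘ./ 1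
  b′ = + 3 ℚᵘ./ 1
  d′ = + 2 ℚᵘ./ suc c

  -- The unsimplified numerator that unnormalised arithmetic produces, with `2n` for `x` and `c` for
  -- `y`.
  numerator : ℤ.ℤ → ℤ.ℤ → ℤ.ℤ
  numerator x y =
    + 1 ℤ.* (((+ 3 ℤ.+ x) ℤ.* + 1 ℤ.+ + 3 ℤ.* + 1) ℤ.* (+ 1 ℤ.+ y) ℤ.+ ℤ.- + 2 ℤ.* + 1)

  ring : ∀ x y →
    + 1 ℤ.* (((+ 3 ℤ.+ x ℤ.* + 2) ℤ.* + 1 ℤ.+ + 3 ℤ.* + 1) ℤ.* (+ 1 ℤ.+ y) ℤ.+ ℤ.- + 2 ℤ.* + 1)
      ℤ.* (+ 1 ℤ.+ y)
    ≡ (+ 2 ℤ.+ x ℤ.+ y ℤ.* (+ 3 ℤ.+ x)) ℤ.* (+ 2 ℤ.* (+ 1 ℤ.* (+ 1 ℤ.+ y)))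
  ring = ℤ-solver.solve-∀

  cross-multiplied : numerator (+ (n ℕ.* 2)) (+ c) ℤ.* + suc c ≡ + s ℤ.* + (2 ℕ.* (1 ℕ.* suc c))
  cross-multiplied = trans
    (cong (λ x → numerator x (+ c) ℤ.* + suc c) (ℤ.pos-* n 2))
    (trans (ring (+ n) (+ c))
      (sym (cong₂ (λ x y → (+ 2 ℤ.+ + n ℤ.+ x) ℤ.* y)
        (ℤ.pos-* c (3 ℕ.+ n))
        (trans (ℤ.pos-* 2 (1 ℕ.* suc c)) (cong (+ 2 ℤ.*_) (ℤ.pos-* 1 (suc c)))))))

mainTheorem12 : (p : ℕ) → Prime p → p % 120 ≡ 71 ⊎ p % 120 ≡ 119 →
    (h : ℕ) → IsClassNumber p h → h % 2 ≡ 1 →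
    (P : FracIdeal p) → IsPrimeIdealAbove 2 P →
    (L : ℕ) .{{_ : NonZero L}} → IsClassOrder P L → 3 ≤ L → L ∣ h →
    IsMeanDiam (isogenyGraph h L)
    (½ * (ℕ→ℚ L + ℕ→ℚ 3 - _/_ (+ (4 ℕ.* L)) (h ℕ.+ L) {{+-nonZeroʳ h L}}))
mainTheorem12 p _ _ h _ h-odd _ _ L _ 3≤L L∣h@(divides q h≡q*L)
  = main (L ℕ./ 2 ∸ 1) (q ℕ./ 2) L≡ h≡
  where
  L≡ : L ≡ 3 ℕ.+ (L ℕ./ 2 ∸ 1) ℕ.* 2
  L≡ = trans L≡1+2[L/2] (cong (λ k → 1 ℕ.+ k ℕ.* 2)
    -- `3 ≤ L` gives `1 ≤ L / 2`, so the truncated subtraction is exact.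
    (sym (ℕ.m+[n∸m]≡n {1} {L ℕ./ 2} (/-monoˡ-≤ 2 (ℕ.≤-trans (s≤s (s≤s z≤n)) 3≤L)))))
    where
    L≡1+2[L/2] : L ≡ 1 ℕ.+ L ℕ./ 2 ℕ.* 2
    L≡1+2[L/2] = odd⇒half L (∣-odd L∣h h-odd)

  h≡ : h ≡ (1 ℕ.+ q ℕ./ 2 ℕ.* 2) ℕ.* L
  h≡ = trans h≡q*L (cong (ℕ._* L)
    -- The cofactor `q` also divides the odd number `h`.
    (odd⇒half q (∣-odd (divides L (trans h≡q*L (ℕ.*-comm q L))) h-odd)))

  -- With `n` and `c` as variables, matching on `refl` replaces `L` and `h` by explicit expressions.
  main : ∀ n c → L ≡ 3 ℕ.+ n ℕ.* 2 → h ≡ (1 ℕ.+ c ℕ.* 2) ℕ.* L →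
         IsMeanDiam (isogenyGraph h L)
           (½ * (ℕ→ℚ L + ℕ→ℚ 3 - _/_ (+ (4 ℕ.* L)) (h ℕ.+ L) {{+-nonZeroʳ h L}}))
  main n c refl refl = subst₂ (λ k → IsMeanDiam (folded L ⊎ᴳ copies k (stacked L)))
    (sym (stackedCount-odd c L))
    (sym (trans
      (cong (λ x → ½ * (ℕ→ℚ L + ℕ→ℚ 3 - x))
        (4L/[h+L] c L {{_}} {{+-nonZeroʳ ((1 ℕ.+ c ℕ.* 2) ℕ.* L) L}}))
      (mean-formula n c)))
    (meanDiam-⊎-copies (folded L) (stacked L) c zero zero
      (Folded.diameter n) (Stacked.diameter n))
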